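{- For every $k\ge2$, the integrality gap of (LP-MUHV), the linear programming relaxation of the MUHV problem with $k$ colors, has a lower bound of $2-\frac2k$: $$\sup_{I}\ \frac{\mathrm{OPT}(\mathrm{MUHV})(I)}{\mathrm{OPT}(\text{LP-MUHV})(I)}\ \ge\ 2-\frac2k,$$ where the supremum is over all MUHV instances $I$ with $k$ colors and $\mathrm{OPT}(\text{LP-MUHV})(I)>0$.
   Context: **MUHV problem.** An instance consists of a finite undirected graph $G=(V,E)$, $V=\{v_1,\dots,v_n\}$, non-negative vertex weights $w_j=w(v_j)$, a color set $C=\{1,\dots,k\}$, and a partial vertex coloring $c$ with colors in $C$ in which every color is used on at least one vertex. $\mathrm{OPT}(\mathrm{MUHV})(I)$ is the minimum, over all colorings of $V$ extending $c$, of the total weight of unhappy vertices (vertices whose color differs from that of at least one neighbor). **(LP-MUHV).** $\mathrm{OPT}(\text{LP-MUHV})(I)$ is the optimum value of: minimize $\sum_{j=1}^n w_jx_j$ subject to: $\sum_{i=1}^k y_j^i=1$ for all $v_j\in V$; $y_j^i=1$ whenever $c(v_j)=i$; $x_j^i\ge y_j^i-y_h^i$ for all $v_j\in V$, $v_h\in N(v_j)$, $i\in C$; $x_j=\sum_{i=1}^k x_j^i$ for all $v_j\in V$; and $y_j^i,x_j^i,x_j\ge0$. Here $N(v_j)$ is the set of neighbors of $v_j$.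
   Formalization: The vertex weights and the LP variables are rational rather than real, so OPT(LP-MUHV) is the optimum over rational feasible points; for rational weights this equals the real optimum, by a standard fact that is not proved. -}

module Defs where

open import Algebra.Properties.CommutativeMonoid.Sum using (sum)
open import Data.Bool using (if_then_else_)
open import Data.Fin using (Fin)
open import Data.Fin.Properties using (any?; _≟_)
open import Data.Maybe using (Maybe; just)
open import Data.Nat using (ℕ)
open import Data.Product using (∃-syntax; _×_)
open import Data.Rational
  using (ℚ; 0ℚ; 1ℚ; _*_; _-_; _÷_; _≤_; _<_; _≥_; >-nonZero)
open import Data.Rational.Properties using (+-0-commutativeMonoid)
open import Level using (0ℓ; _⊔_)
open import Relation.Binary using (Rel; Decidable; Symmetric; Irreflexive)
open import Relation.Binary.PropositionalEquality using (_≡_; _≢_)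
open import Relation.Nullary using (Dec; does; ¬?; _×-dec_)
open import Relation.Unary using (Pred)

∑ : ∀ {n} → (Fin n → ℚ) → ℚ
∑ = sum +-0-commutativeMonoid

record IsMinimum {a p} {A : Set a} (Feasible : A → Set p) (objective : A → ℚ)
                 (m : ℚ) : Set (a ⊔ p) where
  field
    attained   : ∃[ s ] (Feasible s × objective s ≡ m)
    lowerBound : ∀ s → Feasible s → m ≤ objective s

-- ℓ ≤ sup S, where the supremum is taken in the extended reals: it need be
-- neither rational, nor finite, nor attained.
infix 4 _≤sup_
_≤sup_ : ∀ {a} → ℚ → Pred ℚ a → Set a
ℓ ≤sup S = ∀ r → r < ℓ → ∃[ s ] (S s × r < s)

record Graph (n : ℕ) : Set₁ where
  field
    Adj    : Rel (Fin n) 0ℓ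
    adj?   : Decidable Adj
    symm   : Symmetric Adj
    irrefl : Irreflexive _≡_ Adj

-- Weights, and below the LP variables, are rational rather than real. A linear
-- program with rational data has the same optimum over ℚ as over ℝ, so a lower
-- bound on the supremum over these instances is one over real-weighted ones.
record Instance (k : ℕ) : Set₁ where
  field
    n         : ℕ
    graph     : Graph n
    w         : Fin n → ℚ
    w≥0       : ∀ v → w v ≥ 0ℚ
    c         : Fin n → Maybe (Fin k)
    everyUsed : ∀ i → ∃[ v ] c v ≡ just i
  open Graph graph public

module _ {k : ℕ} (I : Instance k) where
  open Instance I

  Coloring : Set
  Coloring = Fin n → Fin k

  Extends : Coloring → Set
  Extends f = ∀ v i → c v ≡ just i → f v ≡ i

  Unhappy : Coloring → Fin n → Set
  Unhappy f v = ∃[ u ] (Adj v u × f v ≢ f u)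

  unhappy? : ∀ f v → Dec (Unhappy f v)
  unhappy? f v = any? λ u → adj? v u ×-dec ¬? (f v ≟ f u)

  unhappyWeight : Coloring → ℚ
  unhappyWeight f = ∑ λ v → if does (unhappy? f v) then w v else 0ℚ

  IsOPT-MUHV : ℚ → Set
  IsOPT-MUHV = IsMinimum Extends unhappyWeight

  -- Here xᶜ v i stands for x_v^i.
  record LPPoint : Set where
    field
      x  : Fin n → ℚ
      xᶜ : Fin n → Fin k → ℚ
      y  : Fin n → Fin k → ℚ

  record LPFeasible (p : LPPoint) : Set where
    open LPPoint p
    field
      y-sum   : ∀ v → ∑ (y v) ≡ 1ℚ
      y-fixed : ∀ v i → c v ≡ just i → y v i ≡ 1ℚ
      xᶜ-edge : ∀ v u → Adj v u → ∀ i → xᶜ v i ≥ y v i - y u i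
      x-sum   : ∀ v → x v ≡ ∑ (xᶜ v)
      y≥0     : ∀ v i → y v i ≥ 0ℚ
      xᶜ≥0    : ∀ v i → xᶜ v i ≥ 0ℚ
      x≥0     : ∀ v → x v ≥ 0ℚ

  LPObjective : LPPoint → ℚ
  LPObjective p = ∑ λ v → w v * LPPoint.x p v

  IsOPT-LP-MUHV : ℚ → Set
  IsOPT-LP-MUHV = IsMinimum LPFeasible LPObjective

record GapRatio (k : ℕ) (ρ : ℚ) : Set₁ where
  field
    I     : Instance k
    opt   : ℚ
    lp    : ℚ
    isOpt : IsOPT-MUHV I opt
    isLP  : IsOPT-LP-MUHV I lp
    lp>0  : 0ℚ < lp
    ratio : ρ ≡ _÷_ opt lp {{>-nonZero lp>0}}

{-# OPTIONS --safe #-}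
-- The gap is attained by one instance with k colours. Hub i is precoloured i and
-- has weight 1; for each pair (i , j) an uncoloured, weightless link vertex is
-- joined to hubs i and j. Two happy hubs would force both their colours on their
-- common link, so in a colouring at most one hub is happy and OPT = k - 1. In the
-- LP, x_i ≥ 1 - y_u^i for every link u of hub i, so x_i + x_j ≥ 1 for i ≠ j and
-- the optimum is k / 2, attained when each link takes its two colours half each.
module Submission where

open import Defs
open import Data.Nat using (ℕ; NonZero; _≤_)
open import Data.Integer using (+_)
open import Data.Rational using (_-_; _/_)

open import Algebra.Bundles using (CommutativeRing)
open import Algebra.Properties.CommutativeMonoid.Sum using (sum-cong-≗; sum-replicate-zero; ∑-distrib-+)
open import Algebra.Properties.Semiring.Sum using (*-distribˡ-sum)
open import Data.Bool using (if_then_else_; true; false)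
open import Data.Bool.Properties using (if-eta)
open import Data.Empty using (⊥)
open import Data.Fin using (Fin; zero; suc; _↑ˡ_; _↑ʳ_; splitAt; combine; remQuot)
open import Data.Fin.Properties using (_≟_; splitAt-↑ˡ; splitAt-↑ʳ; remQuot-combine; suc-injective)
import Data.Integer as ℤ
import Data.Integer.Properties as ℤ
import Data.Integer.Solver as ℤ
open import Data.Maybe using (Maybe; just; nothing)
open import Data.Nat as ℕ using (zero; suc; s≤s; z≤n)
import Data.Nat.Properties as ℕ
open import Data.Product using (_×_; _,_; proj₂)
open import Data.Rational as ℚ using (ℚ; 0ℚ; 1ℚ; ½; _+_; _*_; _÷_; 1/_; toℚᵘ; >-nonZero)
open import Data.Rational.Properties hiding (_≟_)
open import Data.Rational.Solver using (module +-*-Solver)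
open import Data.Rational.Unnormalised as ℚᵘ using (mkℚᵘ; *≡*)
import Data.Rational.Unnormalised.Properties as ℚᵘ
open import Data.Sum using (_⊎_; inj₁; inj₂; map₁; map₂; [_,_]′)
open import Function using (_∘_)
open import Relation.Binary.PropositionalEquality
open import Relation.Nullary using (Dec; no; does; ¬_; contradiction; _⊎-dec_)
open import Relation.Nullary.Decidable using (decidable-stable; dec-true; dec-false; toSum)

-- Finite sums and arithmetic of rationals.

∑-mono-≤ : ∀ {n} {f g : Fin n → ℚ} → (∀ i → f i ℚ.≤ g i) → ∑ f ℚ.≤ ∑ g
∑-mono-≤ {zero}  f≤g = ≤-refl
∑-mono-≤ {suc n} f≤g = +-mono-≤ (f≤g zero) (∑-mono-≤ (f≤g ∘ suc))

∑-cong : ∀ {n} {f g : Fin n → ℚ} → f ≗ g → ∑ f ≡ ∑ g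
∑-cong = sum-cong-≗ +-0-commutativeMonoid

∑-zero : ∀ n → ∑ {n} (λ _ → 0ℚ) ≡ 0ℚ
∑-zero = sum-replicate-zero +-0-commutativeMonoid

∑-nonneg : ∀ {n} {f : Fin n → ℚ} → (∀ i → 0ℚ ℚ.≤ f i) → 0ℚ ℚ.≤ ∑ f
∑-nonneg {n} {f} 0≤f = subst (ℚ._≤ ∑ f) (∑-zero n) (∑-mono-≤ 0≤f)

∑-*ˡ : ∀ {n} q (f : Fin n → ℚ) → ∑ (λ i → q * f i) ≡ q * ∑ f
∑-*ˡ q f = sym (*-distribˡ-sum (CommutativeRing.semiring +-*-commutativeRing) q f)

term≤∑ : ∀ {n} {f : Fin n → ℚ} → (∀ i → 0ℚ ℚ.≤ f i) → ∀ i → f i ℚ.≤ ∑ f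
term≤∑ {suc n} {f} 0≤f zero =
  subst (ℚ._≤ ∑ f) (+-identityʳ _) (+-monoʳ-≤ (f zero) (∑-nonneg (0≤f ∘ suc)))
term≤∑ {suc n} {f} 0≤f (suc i) =
  subst (ℚ._≤ ∑ f) (+-identityˡ _) (+-mono-≤ (0≤f zero) (term≤∑ (0≤f ∘ suc) i))

two-terms≤∑ : ∀ {n} {f : Fin n → ℚ} → (∀ i → 0ℚ ℚ.≤ f i) →
              ∀ i j → i ≢ j → f i + f j ℚ.≤ ∑ f
two-terms≤∑ 0≤f zero zero i≢j = contradiction refl i≢j
two-terms≤∑ {f = f} 0≤f zero (suc j) _ = +-monoʳ-≤ (f zero) (term≤∑ (0≤f ∘ suc) j)
two-terms≤∑ {f = f} 0≤f (suc i) zero _ =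
  subst (ℚ._≤ ∑ f) (+-comm (f zero) _) (+-monoʳ-≤ (f zero) (term≤∑ (0≤f ∘ suc) i))
two-terms≤∑ {f = f} 0≤f (suc i) (suc j) i≢j =
  subst (ℚ._≤ ∑ f) (+-identityˡ _)
    (+-mono-≤ (0≤f zero) (two-terms≤∑ (0≤f ∘ suc) i j (i≢j ∘ cong suc)))

-- Reduces both objectives to sums over the hubs: these are numbered first, and the links after them
-- weigh nothing.
∑-↑ˡ : ∀ k {m} (f : Fin (k ℕ.+ m) → ℚ) → (∀ j → f (k ↑ʳ j) ≡ 0ℚ) →
       ∑ f ≡ ∑ {k} (λ i → f (i ↑ˡ m))
∑-↑ˡ zero    {m} f f≡0 = trans (∑-cong f≡0) (∑-zero m)
∑-↑ˡ (suc k)     f f≡0 = cong (λ s → f zero + s) (∑-↑ˡ k (f ∘ suc) f≡0)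

-- As a sum of ones, `# (suc n)` unfolds to `1ℚ + # n`, which fits both the inductions below and
-- termwise bounds by `1ℚ`.
#_ : ℕ → ℚ
# n = ∑ {n} λ _ → 1ℚ

toℚᵘ-# : ∀ n → toℚᵘ (# n) ℚᵘ.≃ mkℚᵘ (+ n) 0
toℚᵘ-# zero    = ℚᵘ.≃-refl
toℚᵘ-# (suc n) = ℚᵘ.≃-trans (toℚᵘ-homo-+ 1ℚ (# n))
  (ℚᵘ.≃-trans (ℚᵘ.+-congʳ (toℚᵘ 1ℚ) (toℚᵘ-# n)) (*≡* (solve 1
    (λ x → (con (+ 1) :* con (+ 1) :+ x :* con (+ 1)) :* con (+ 1) := (con (+ 1) :+ x) :* con (+ 1))
    refl (+ n))))
  where open ℤ.+-*-Solver

-- Unnormalised rationals keep `i / n` as a literal fraction, so no gcd intervenes and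
-- cross-multiplication settles the claim.
/-*-# : ∀ i n .{{_ : NonZero n}} → (i / n) * # n ≡ i / 1
/-*-# i n@(suc n-1) = toℚᵘ-injective (begin
  toℚᵘ ((i / n) * # n)             ≈⟨ toℚᵘ-homo-* (i / n) (# n) ⟩
  toℚᵘ (i / n) ℚᵘ.* toℚᵘ (# n)     ≈⟨ ℚᵘ.*-cong (toℚᵘ-fromℚᵘ (mkℚᵘ i n-1)) (toℚᵘ-# n) ⟩
  mkℚᵘ i n-1 ℚᵘ.* mkℚᵘ (+ n) 0     ≈⟨ cancel ⟩
  mkℚᵘ i 0                         ≈⟨ ℚᵘ.≃-sym (toℚᵘ-fromℚᵘ (mkℚᵘ i 0)) ⟩
  toℚᵘ (i / 1)                     ∎)
  where
  open import Relation.Binary.Reasoning.Setoid ℚᵘ.≃-setoid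
  cancel : mkℚᵘ i n-1 ℚᵘ.* mkℚᵘ (+ n) 0 ℚᵘ.≃ mkℚᵘ i 0
  cancel = *≡* (trans (ℤ.*-identityʳ (i ℤ.* + n)) (cong (λ d → i ℤ.* + d) (sym (ℕ.*-identityʳ n))))

p*q≡r⇒p≡r÷q : ∀ {p q r} .{{_ : ℚ.NonZero q}} → p * q ≡ r → p ≡ r ÷ q
p*q≡r⇒p≡r÷q {p} {q} {r} pq≡r = begin
  p               ≡⟨ *-identityʳ p ⟨
  p * 1ℚ          ≡⟨ cong (p *_) (*-inverseʳ q) ⟨
  p * (q * 1/ q)  ≡⟨ *-assoc p q (1/ q) ⟨
  p * q * 1/ q    ≡⟨ cong (_* 1/ q) pq≡r ⟩
  r ÷ q           ∎
  where open ≡-Reasoning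

½*-nonneg : ∀ {p} → 0ℚ ℚ.≤ p → 0ℚ ℚ.≤ ½ * p
½*-nonneg 0≤p = *-monoˡ-≤-nonNeg ½ 0≤p

-- Kronecker delta.

δ : ∀ {k} → Fin k → Fin k → ℚ
δ i j = if does (i ≟ j) then 1ℚ else 0ℚ

δ-refl : ∀ {k} (i : Fin k) → δ i i ≡ 1ℚ
δ-refl i rewrite dec-true (i ≟ i) refl = refl

δ≥0 : ∀ {k} (i j : Fin k) → 0ℚ ℚ.≤ δ i j
δ≥0 i j with does (i ≟ j)
... | true  = nonNegative⁻¹ 1ℚ
... | false = ≤-refl

∑-δ : ∀ {k} (i : Fin k) → ∑ (δ i) ≡ 1ℚ
∑-δ {suc k} zero    = cong (λ s → 1ℚ + s) (∑-zero k)
∑-δ {suc k} (suc i) = trans (+-identityˡ _) (∑-δ i)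

-- The two sides differ by `½ * δ j c`. This is the LP edge constraint from hub `i` to a link of
-- hubs `i` and `j`.
δ-half : ∀ {k} (i j c : Fin k) → δ i c ℚ.≤ ½ * (δ i c + δ j c) + ½ * δ i c
δ-half i j c = subst₂ ℚ._≤_ (+-identityʳ _)
  (solve 2 (λ a b → a :+ con ½ :* b := con ½ :* (a :+ b) :+ con ½ :* a) refl (δ i c) (δ j c))
  (+-monoʳ-≤ (δ i c) (½*-nonneg (δ≥0 j c)))
  where open +-*-Solver

p-q≤r⇒p≤r+q : ∀ {p q r} → p - q ℚ.≤ r → p ℚ.≤ r + q
p-q≤r⇒p≤r+q {p} {q} {r} p-q≤r =
  subst (ℚ._≤ r + q) (solve 2 (λ p q → p :- q :+ q := p) refl p q) (+-monoˡ-≤ q p-q≤r)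
  where open +-*-Solver

p≤q+r⇒p-q≤r : ∀ {p q r} → p ℚ.≤ q + r → p - q ℚ.≤ r
p≤q+r⇒p-q≤r {p} {q} {r} p≤q+r =
  subst (p - q ℚ.≤_) (solve 2 (λ q r → q :+ r :- q := r) refl q r) (+-monoˡ-≤ (ℚ.- q) p≤q+r)
  where open +-*-Solver

-- Sums of numbers any two of which add up to at least 1.

pairwise⇒half≤∑ : ∀ m (x : Fin (suc (suc m)) → ℚ) →
                  (∀ i j → i ≢ j → 1ℚ ℚ.≤ x i + x j) → ½ * # (suc (suc m)) ℚ.≤ ∑ x
pairwise⇒half≤∑ zero x pair =
  subst (1ℚ ℚ.≤_) (cong (λ s → x zero + s) (sym (+-identityʳ _))) (pair zero (suc zero) λ ())
-- The induction removes two terms at a time, so odd lengths need their own base case. The three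
-- pairs count each term twice, hence the factor `½`.
pairwise⇒half≤∑ (suc zero) x pair =
  subst (_ ℚ.≤_)
    (solve 3 (λ a b c → con ½ :* ((a :+ b) :+ ((a :+ c) :+ (b :+ c))) := a :+ (b :+ (c :+ con 0ℚ)))
      refl (x zero) (x (suc zero)) (x (suc (suc zero))))
    (*-monoˡ-≤-nonNeg ½ (+-mono-≤ (pair zero (suc zero) λ ())
      (+-mono-≤ (pair zero (suc (suc zero)) λ ()) (pair (suc zero) (suc (suc zero)) λ ()))))
  where open +-*-Solver
-- The first two terms give 1 by their own pair, exactly what `½ * #_` loses when the length drops
-- by two.
pairwise⇒half≤∑ (suc (suc m)) x pair =
  subst₂ ℚ._≤_
    (solve 1 (λ s → con 1ℚ :+ con ½ :* s := con ½ :* (con 1ℚ :+ (con 1ℚ :+ s))) refl (# (suc (suc m))))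
    (+-assoc (x zero) (x (suc zero)) _)
    (+-mono-≤ (pair zero (suc zero) λ ())
      (pairwise⇒half≤∑ m (λ i → x (suc (suc i)))
        λ i j i≢j → pair (suc (suc i)) (suc (suc j)) (i≢j ∘ suc-injective ∘ suc-injective)))
  where open +-*-Solver

-- At most one term can be 0. If the first one is, all others are at least 1; if it is 1, it pays
-- for itself and the induction continues.
pairwise⇒pred≤∑ : ∀ m (u : Fin (suc m) → ℚ) → (∀ i → u i ≡ 0ℚ ⊎ u i ≡ 1ℚ) →
                  (∀ i j → i ≢ j → 1ℚ ℚ.≤ u i + u j) → # m ℚ.≤ ∑ u
pairwise⇒pred≤∑ m u binary pair with binary zero
... | inj₁ u₀≡0 =
  subst (ℚ._≤ ∑ u) (+-identityˡ (# m))
    (+-mono-≤ (≤-reflexive (sym u₀≡0)) (∑-mono-≤ 1≤u))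
  where
  1≤u : ∀ i → 1ℚ ℚ.≤ u (suc i)
  1≤u i = subst (1ℚ ℚ.≤_) (trans (cong (_+ u (suc i)) u₀≡0) (+-identityˡ _)) (pair zero (suc i) λ ())
pairwise⇒pred≤∑ zero    u binary pair | inj₂ u₀≡1 =
  subst (0ℚ ℚ.≤_) (sym (trans (+-identityʳ _) u₀≡1)) (nonNegative⁻¹ 1ℚ)
pairwise⇒pred≤∑ (suc m) u binary pair | inj₂ u₀≡1 =
  +-mono-≤ (≤-reflexive (sym u₀≡1))
    (pairwise⇒pred≤∑ m (u ∘ suc) (binary ∘ suc) λ i j i≢j → pair (suc i) (suc j) (i≢j ∘ suc-injective))

-- The hub and link instance.

module Gap (k : ℕ) where

  -- inj₁ i is hub i and inj₂ (i , j) a link of hubs i and j. All ordered pairs are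
  -- allowed: the duplicates and the pendant links (i , i) are harmless.
  Vertex : Set
  Vertex = Fin k ⊎ Fin k × Fin k

  -- The data of the instance are defined by cases on `Vertex` and pulled back along `decode`.
  decode : Fin (k ℕ.+ k ℕ.* k) → Vertex
  decode = map₂ (remQuot k) ∘ splitAt k

  hub : Fin k → Fin (k ℕ.+ k ℕ.* k)
  hub i = i ↑ˡ (k ℕ.* k)

  link : Fin k → Fin k → Fin (k ℕ.+ k ℕ.* k)
  link i j = k ↑ʳ combine i j

  decode-hub : ∀ i → decode (hub i) ≡ inj₁ i
  decode-hub i = cong (map₂ (remQuot k)) (splitAt-↑ˡ k i (k ℕ.* k))

  decode-↑ʳ : ∀ j → decode (k ↑ʳ j) ≡ inj₂ (remQuot k j)
  decode-↑ʳ j = cong (map₂ (remQuot k)) (splitAt-↑ʳ k (k ℕ.* k) j)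

  decode-link : ∀ i j → decode (link i j) ≡ inj₂ (i , j)
  decode-link i j = trans (decode-↑ʳ (combine i j)) (cong inj₂ (remQuot-combine i j))

  Joined : Vertex → Vertex → Set
  Joined (inj₁ i)       (inj₂ (j , l)) = i ≡ j ⊎ i ≡ l
  Joined (inj₂ (j , l)) (inj₁ i)       = i ≡ j ⊎ i ≡ l
  Joined _              _              = ⊥

  joined? : ∀ a b → Dec (Joined a b)
  joined? (inj₁ i)       (inj₂ (j , l)) = (i ≟ j) ⊎-dec (i ≟ l)
  joined? (inj₂ (j , l)) (inj₁ i)       = (i ≟ j) ⊎-dec (i ≟ l)
  joined? (inj₁ _)       (inj₁ _)       = no λ ()
  joined? (inj₂ _)       (inj₂ _)       = no λ ()

  joined-sym : ∀ a b → Joined a b → Joined b a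
  joined-sym (inj₁ _) (inj₂ _) p = p
  joined-sym (inj₂ _) (inj₁ _) p = p

  joined-irrefl : ∀ a → ¬ Joined a a
  joined-irrefl (inj₁ _) ()
  joined-irrefl (inj₂ _) ()

  weight : Vertex → ℚ
  weight (inj₁ _) = 1ℚ
  weight (inj₂ _) = 0ℚ

  weight≥0 : ∀ a → 0ℚ ℚ.≤ weight a
  weight≥0 (inj₁ _) = nonNegative⁻¹ 1ℚ
  weight≥0 (inj₂ _) = ≤-refl

  precolor : Vertex → Maybe (Fin k)
  precolor (inj₁ i) = just i
  precolor (inj₂ _) = nothing

  -- The half-integral LP solution, on `Vertex`.

  ŷ : Vertex → Fin k → ℚ
  ŷ (inj₁ i)       = δ i
  ŷ (inj₂ (i , j)) = λ c → ½ * (δ i c + δ j c)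

  -- A hub loses half of its own colour on each link to another hub, and nothing in other colours.
  -- On links the generous choice `ŷ` costs nothing, their weight being 0.
  x̂ : Vertex → Fin k → ℚ
  x̂ (inj₁ i) = λ c → ½ * δ i c
  x̂ (inj₂ p) = ŷ (inj₂ p)

  ŷ≥0 : ∀ a c → 0ℚ ℚ.≤ ŷ a c
  ŷ≥0 (inj₁ i)       c = δ≥0 i c
  ŷ≥0 (inj₂ (i , j)) c = ½*-nonneg (+-mono-≤ (δ≥0 i c) (δ≥0 j c))

  x̂≥0 : ∀ a c → 0ℚ ℚ.≤ x̂ a c
  x̂≥0 (inj₁ i) c = ½*-nonneg (δ≥0 i c)
  x̂≥0 (inj₂ p) c = ŷ≥0 (inj₂ p) c

  ∑-ŷ : ∀ a → ∑ (ŷ a) ≡ 1ℚ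
  ∑-ŷ (inj₁ i)       = ∑-δ i
  ∑-ŷ (inj₂ (i , j)) = begin
    ∑ (λ c → ½ * (δ i c + δ j c))  ≡⟨ ∑-*ˡ ½ (λ c → δ i c + δ j c) ⟩
    ½ * ∑ (λ c → δ i c + δ j c)    ≡⟨ cong (½ *_) (∑-distrib-+ +-0-commutativeMonoid (δ i) (δ j)) ⟩
    ½ * (∑ (δ i) + ∑ (δ j))        ≡⟨ cong₂ (λ p q → ½ * (p + q)) (∑-δ i) (∑-δ j) ⟩
    1ℚ                             ∎
    where open ≡-Reasoning

  ŷ-fixed : ∀ a i → precolor a ≡ just i → ŷ a i ≡ 1ℚ
  ŷ-fixed (inj₁ i) .i refl = δ-refl i

  x̂-edge : ∀ a b → Joined a b → ∀ c → ŷ a c - ŷ b c ℚ.≤ x̂ a c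
  x̂-edge (inj₁ i) (inj₂ (.i , l)) (inj₁ refl) c = p≤q+r⇒p-q≤r (δ-half i l c)
  x̂-edge (inj₁ i) (inj₂ (j , .i)) (inj₂ refl) c = p≤q+r⇒p-q≤r
    (subst (λ q → δ i c ℚ.≤ ½ * q + ½ * δ i c) (+-comm (δ i c) (δ j c)) (δ-half i j c))
  -- On a link `x̂` equals `ŷ`, so the constraint only asks that the value at the hub be
  -- nonnegative.
  x̂-edge (inj₂ p) (inj₁ i) _ c = p≤q+r⇒p-q≤r {ŷ (inj₂ p) c} {δ i c}
    (subst (ℚ._≤ δ i c + ŷ (inj₂ p) c) (+-identityˡ _) (+-monoˡ-≤ (ŷ (inj₂ p) c) (δ≥0 i c)))

  -- The instance on numbered vertices.

  graph : Graph (k ℕ.+ k ℕ.* k)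
  graph = record
    { Adj    = λ v u → Joined (decode v) (decode u)
    ; adj?   = λ v u → joined? (decode v) (decode u)
    ; symm   = λ {v} {u} → joined-sym (decode v) (decode u)
    ; irrefl = λ { {v} refl → joined-irrefl (decode v) }
    }

  I : Instance k
  I = record
    { n         = k ℕ.+ k ℕ.* k
    ; graph     = graph
    ; w         = weight ∘ decode
    ; w≥0       = weight≥0 ∘ decode
    ; c         = precolor ∘ decode
    ; everyUsed = λ i → hub i , cong precolor (decode-hub i)
    }

  open Instance I hiding (graph)

  w-hub : ∀ i → w (hub i) ≡ 1ℚ
  w-hub i = cong weight (decode-hub i)

  w-↑ʳ : ∀ j → w (k ↑ʳ j) ≡ 0ℚ
  w-↑ʳ j = cong weight (decode-↑ʳ j)

  c-hub : ∀ i → c (hub i) ≡ just i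
  c-hub i = cong precolor (decode-hub i)

  adj-linkˡ : ∀ i j → Adj (hub i) (link i j)
  adj-linkˡ i j = subst₂ Joined (sym (decode-hub i)) (sym (decode-link i j)) (inj₁ refl)

  adj-linkʳ : ∀ i j → Adj (hub j) (link i j)
  adj-linkʳ i j = subst₂ Joined (sym (decode-hub j)) (sym (decode-link i j)) (inj₂ refl)

  -- Upper and lower bounds on the LP value.

  lpPoint : LPPoint I
  lpPoint = record { x = λ v → ∑ (x̂ (decode v)) ; xᶜ = x̂ ∘ decode ; y = ŷ ∘ decode }

  lpPoint-feasible : LPFeasible I lpPoint
  lpPoint-feasible = record
    { y-sum   = ∑-ŷ ∘ decode
    ; y-fixed = ŷ-fixed ∘ decode
    ; xᶜ-edge = λ v u → x̂-edge (decode v) (decode u)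
    ; x-sum   = λ _ → refl
    ; y≥0     = ŷ≥0 ∘ decode
    ; xᶜ≥0    = x̂≥0 ∘ decode
    ; x≥0     = λ v → ∑-nonneg (x̂≥0 (decode v))
    }

  objective-hubs : ∀ p → LPObjective I p ≡ ∑ (LPPoint.x p ∘ hub)
  objective-hubs p = trans
    (∑-↑ˡ k _ λ j → trans (cong (_* x (k ↑ʳ j)) (w-↑ʳ j)) (*-zeroˡ (x (k ↑ʳ j))))
    (∑-cong λ i → trans (cong (_* x (hub i)) (w-hub i)) (*-identityˡ (x (hub i))))
    where open LPPoint p

  lpPoint-objective : LPObjective I lpPoint ≡ ½ * # k
  lpPoint-objective = trans (objective-hubs lpPoint) (trans (∑-cong x-hub) (∑-*ˡ {k} ½ λ _ → 1ℚ))
    where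
    x-hub : ∀ i → ∑ (x̂ (decode (hub i))) ≡ ½ * 1ℚ
    x-hub i = trans (cong (∑ ∘ x̂) (decode-hub i)) (trans (∑-*ˡ ½ (δ i)) (cong (½ *_) (∑-δ i)))

  module _ {p : LPPoint I} (feasible : LPFeasible I p) where
    open LPPoint p
    open LPFeasible feasible

    -- Colour `i` alone suffices: the hub holds all of it, and the remaining components of `x` are
    -- nonnegative.
    1≤x+y : ∀ i u → Adj (hub i) u → 1ℚ ℚ.≤ x (hub i) + y u i
    1≤x+y i u hub~u = p-q≤r⇒p≤r+q (begin
      1ℚ - y u i           ≡⟨ cong (_- y u i) (y-fixed (hub i) i (c-hub i)) ⟨
      y (hub i) i - y u i  ≤⟨ xᶜ-edge (hub i) u hub~u i ⟩
      xᶜ (hub i) i         ≤⟨ term≤∑ (xᶜ≥0 (hub i)) i ⟩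
      ∑ (xᶜ (hub i))       ≡⟨ x-sum (hub i) ⟨
      x (hub i)            ∎)
      where open ≤-Reasoning

    -- Add `1≤x+y` for both hubs at their common link. Its shares of the distinct colours `i` and
    -- `j` total at most 1, which leaves at least 1 of the 2 for the hubs.
    1≤x+x : ∀ i j → i ≢ j → 1ℚ ℚ.≤ x (hub i) + x (hub j)
    1≤x+x i j i≢j = p≤q+r⇒p-q≤r {1ℚ + 1ℚ} {1ℚ} (begin
      1ℚ + 1ℚ
        ≤⟨ +-mono-≤ (1≤x+y i ij (adj-linkˡ i j)) (1≤x+y j ij (adj-linkʳ i j)) ⟩
      (x (hub i) + y ij i) + (x (hub j) + y ij j)  ≡⟨ rearrange (x (hub i)) (y ij i) (x (hub j)) (y ij j) ⟩
      (y ij i + y ij j) + (x (hub i) + x (hub j))  ≤⟨ +-monoˡ-≤ _ (two-terms≤∑ (y≥0 ij) i j i≢j) ⟩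
      ∑ (y ij) + (x (hub i) + x (hub j))           ≡⟨ cong (_+ (x (hub i) + x (hub j))) (y-sum ij) ⟩
      1ℚ + (x (hub i) + x (hub j))                 ∎)
      where
      open ≤-Reasoning
      ij = link i j
      rearrange : ∀ a b c d → (a + b) + (c + d) ≡ (b + d) + (a + c)
      rearrange = solve 4 (λ a b c d → (a :+ b) :+ (c :+ d) := (b :+ d) :+ (a :+ c)) refl
        where open +-*-Solver

  -- Happy and unhappy hubs in a colouring.

  module _ (f : Coloring I) where

    private
      unhappy = Unhappy I f

    unhappyTerm : Fin n → ℚ
    unhappyTerm v = if does (unhappy? I f v) then w v else 0ℚ

    unhappyWeight-hubs : unhappyWeight I f ≡ ∑ (unhappyTerm ∘ hub)
    unhappyWeight-hubs = ∑-↑ˡ k unhappyTerm λ j →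
      trans (cong (if does (unhappy? I f (k ↑ʳ j)) then_else 0ℚ) (w-↑ʳ j))
            (if-eta (does (unhappy? I f (k ↑ʳ j))))

    unhappy-hub : ∀ i → unhappy (hub i) → unhappyTerm (hub i) ≡ 1ℚ
    unhappy-hub i h = trans
      (cong (if_then w (hub i) else 0ℚ) (dec-true (unhappy? I f (hub i)) h))
      (w-hub i)

    happy-hub : ∀ i → ¬ unhappy (hub i) → unhappyTerm (hub i) ≡ 0ℚ
    happy-hub i h =
      cong (if_then w (hub i) else 0ℚ) (dec-false (unhappy? I f (hub i)) h)

    -- The happy case keeps its evidence next to the value, because `happy-hub-unique` consumes it.
    happy⊎unhappy : ∀ i → (¬ unhappy (hub i) × unhappyTerm (hub i) ≡ 0ℚ) ⊎ unhappyTerm (hub i) ≡ 1ℚ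
    happy⊎unhappy i =
      [ inj₂ ∘ unhappy-hub i , (λ h → inj₁ (h , happy-hub i h)) ]′ (toSum (unhappy? I f (hub i)))

    unhappyTerm-binary : ∀ i → unhappyTerm (hub i) ≡ 0ℚ ⊎ unhappyTerm (hub i) ≡ 1ℚ
    unhappyTerm-binary i = map₁ proj₂ (happy⊎unhappy i)

    happy-adj : ∀ {v u} → ¬ unhappy v → Adj v u → f v ≡ f u
    happy-adj {v} {u} happy v~u = decidable-stable (f v ≟ f u) λ fv≢fu → happy (u , v~u , fv≢fu)

    -- A happy hub imposes its precolour on all its neighbours, so the common link would carry both
    -- `i` and `j`.
    happy-hub-unique : Extends I f →
                       ∀ {i j} → ¬ unhappy (hub i) → ¬ unhappy (hub j) → i ≡ j
    happy-hub-unique extends {i} {j} happyᵢ happyⱼ = begin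
      i             ≡⟨ extends (hub i) i (c-hub i) ⟨
      f (hub i)     ≡⟨ happy-adj happyᵢ (adj-linkˡ i j) ⟩
      f (link i j)  ≡⟨ happy-adj happyⱼ (adj-linkʳ i j) ⟨
      f (hub j)     ≡⟨ extends (hub j) j (c-hub j) ⟩
      j             ∎
      where open ≡-Reasoning

    1≤unhappy+unhappy : Extends I f → ∀ i j → i ≢ j →
                        1ℚ ℚ.≤ unhappyTerm (hub i) + unhappyTerm (hub j)
    1≤unhappy+unhappy extends i j i≢j with happy⊎unhappy i | happy⊎unhappy j
    ... | inj₁ (hᵢ , _) | inj₁ (hⱼ , _) = contradiction (happy-hub-unique extends hᵢ hⱼ) i≢j
    ... | inj₁ (_ , uᵢ≡0) | inj₂ uⱼ≡1 = ≤-reflexive (sym (cong₂ _+_ uᵢ≡0 uⱼ≡1))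
    ... | inj₂ uᵢ≡1 | inj₁ (_ , uⱼ≡0) = ≤-reflexive (sym (cong₂ _+_ uᵢ≡1 uⱼ≡0))
    ... | inj₂ uᵢ≡1 | inj₂ uⱼ≡1       = subst₂ (λ p q → 1ℚ ℚ.≤ p + q) (sym uᵢ≡1) (sym uⱼ≡1)
                                          (+-monoʳ-≤ 1ℚ (nonNegative⁻¹ 1ℚ))

-- The two optima and their ratio, for at least two colours.

module Optimum (m : ℕ) where

  private
    k : ℕ
    k = suc (suc m)

  open Gap k

  -- An optimal colouring: hub `zero` is the single happy hub. Favouring `zero` lets the sum over
  -- hubs split off its term by unfolding.
  zeroColoring : Vertex → Fin k
  zeroColoring (inj₁ i) = i
  zeroColoring (inj₂ _) = zero

  zeroColoring-extends : ∀ a i → precolor a ≡ just i → zeroColoring a ≡ i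
  zeroColoring-extends (inj₁ _) _ refl = refl

  zeroColoring-neighbours : ∀ a → Joined (inj₁ zero) a → zeroColoring a ≡ zero
  zeroColoring-neighbours (inj₂ _) _ = refl

  zeroColoring-happy : ¬ Unhappy I (zeroColoring ∘ decode) (hub zero)
  zeroColoring-happy (u , hub~u , ≢) = ≢ (trans (cong zeroColoring (decode-hub zero))
    (sym (zeroColoring-neighbours (decode u) (subst (λ a → Joined a (decode u)) (decode-hub zero) hub~u))))

  zeroColoring-unhappy : ∀ i → Unhappy I (zeroColoring ∘ decode) (hub (suc i))
  -- Every link is coloured `zero`, so any link of this hub would serve as witness.
  zeroColoring-unhappy i = link (suc i) zero , adj-linkˡ (suc i) zero , λ eq →
    contradiction
      (trans (cong zeroColoring (sym (decode-hub (suc i))))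
        (trans eq (cong zeroColoring (decode-link (suc i) zero))))
      λ ()

  gap-opt : IsOPT-MUHV I (# (suc m))
  gap-opt = record
    { attained   = f , zeroColoring-extends ∘ decode ,
                   trans (unhappyWeight-hubs f)
                     (trans (cong₂ _+_ (happy-hub f zero zeroColoring-happy)
                              (∑-cong λ i → unhappy-hub f (suc i) (zeroColoring-unhappy i)))
                       (+-identityˡ (# (suc m))))
    ; lowerBound = λ g extends → subst (# (suc m) ℚ.≤_) (sym (unhappyWeight-hubs g))
                     (pairwise⇒pred≤∑ (suc m) (unhappyTerm g ∘ hub) (unhappyTerm-binary g)
                       (1≤unhappy+unhappy g extends))
    }
    where
    f : Coloring I
    f = zeroColoring ∘ decode

  gap-lp : IsOPT-LP-MUHV I (½ * # k)
  gap-lp = record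
    { attained   = lpPoint , lpPoint-feasible , lpPoint-objective
    ; lowerBound = λ p feasible → subst (½ * # k ℚ.≤_) (sym (objective-hubs p))
                     (pairwise⇒half≤∑ m (LPPoint.x p ∘ hub) (1≤x+x feasible))
    }

  gap-lp>0 : 0ℚ ℚ.< ½ * # k
  gap-lp>0 = *-monoʳ-<-pos ½ (+-mono-<-≤ (positive⁻¹ 1ℚ) (∑-nonneg {suc m} λ _ → nonNegative⁻¹ 1ℚ))

  -- The ratio in product form, so that division enters only once, through `p*q≡r⇒p≡r÷q`.
  gap-value : ((+ 2 / 1) - (+ 2 / k)) * (½ * # k) ≡ # (suc m)
  gap-value = begin
    ((+ 2 / 1) - q) * (½ * # k)
      ≡⟨ solve 2 (λ q s → (con (+ 2 / 1) :- q) :* (con ½ :* s) := s :- con ½ :* (q :* s)) refl q (# k) ⟩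
    # k - ½ * (q * # k)
      -- `q * # k` becomes the rational 2, whose half evaluates to `1ℚ`.
      ≡⟨ cong (λ t → # k - ½ * t) (/-*-# (+ 2) k) ⟩
    # k - 1ℚ
      ≡⟨ solve 1 (λ s → con 1ℚ :+ s :- con 1ℚ := s) refl (# (suc m)) ⟩
    # (suc m)
      ∎
    where
    open ≡-Reasoning
    open +-*-Solver
    q = + 2 / k

theorem11 : (k : ℕ) .{{_ : NonZero k}} → 2 ≤ k →
    ((+ 2 / 1) - (+ 2 / k)) ≤sup GapRatio k
-- The bound is itself a ratio of the family, so one element exceeds every `r` below it.
theorem11 k@(suc (suc m)) (s≤s (s≤s z≤n)) r r<ℓ = (+ 2 / 1) - (+ 2 / k) , gap , r<ℓ
  where
  gap : GapRatio k ((+ 2 / 1) - (+ 2 / k))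
  gap = record
    { I     = Gap.I k
    ; opt   = # (suc m)
    ; lp    = ½ * # k
    ; isOpt = Optimum.gap-opt m
    ; isLP  = Optimum.gap-lp m
    ; lp>0  = Optimum.gap-lp>0 m
    ; ratio = p*q≡r⇒p≡r÷q {{>-nonZero (Optimum.gap-lp>0 m)}} (Optimum.gap-value m)
    }
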